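{- For all integers $n \ge m \ge 4$, \[ R(Q_m, Q_n) \le \left(m - 2 + \frac{9m - 9}{(2m - 3)(m + 1)}\right)n + m + 3. \]
   Context: $Q_k$ denotes the Boolean lattice of dimension $k$: the family of all subsets of a $k$-element ground set (e.g. $[k]=\{1,\dots,k\}$), ordered by inclusion. A subposet $Q'$ of a poset $Q$ is a copy of a poset $P$ if there is a bijection $f$ from $P$ to $Q'$ such that $x \le y$ in $P$ if and only if $f(x) \le f(y)$ in $Q$. For posets $P, P'$, the poset Ramsey number $R(P,P')$ is the smallest integer $N$ such that for every coloring of the elements of $Q_N$ in red and blue, there is a copy of $P$ all of whose elements are red or a copy of $P'$ all of whose elements are blue. -}

module Defs where

open import Data.Nat using (ℕ; _+_; _*_; _∸_; _≤_)
open import Data.Bool using (Bool; true; false)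
open import Data.Fin.Subset using (Subset; _⊆_)
open import Data.Product using (Σ; _×_; ∃)
open import Data.Sum using (_⊎_)
open import Function.Bundles using (_⇔_)
open import Relation.Binary.PropositionalEquality using (_≡_)

Q : ℕ → Set
Q k = Subset k

-- A copy of Q_m inside Q_N: a map f : Q_m → Q_N with  A ⊆ B ⇔ f A ⊆ f B.
-- (Such a map is automatically injective, hence a bijection onto its image,
--  which is exactly the definition of a copy.)
IsCopy : {m N : ℕ} → (Q m → Q N) → Set
IsCopy f = ∀ A B → (A ⊆ B) ⇔ (f A ⊆ f B)

Red Blue : Bool
Red = true
Blue = false

RamseyProp : ℕ → ℕ → ℕ → Set
RamseyProp m n N =
  (c : Q N → Bool) →
    (Σ (Q m → Q N) λ f → IsCopy f × (∀ A → c (f A) ≡ Red))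
    ⊎ (Σ (Q n → Q N) λ g → IsCopy g × (∀ A → c (g A) ≡ Blue))

-- R(Q_m, Q_n) ≤ x  for a real bound x = p / d (d > 0), stated as: some N with
-- N ≤ x has the Ramsey property (R is the least such N), i.e. N * d ≤ p.
RamseyLeFrac : ℕ → ℕ → ℕ → ℕ → Set
RamseyLeFrac m n p d = ∃ λ N → RamseyProp m n N × (N * d ≤ p)

module Submission where

-- Suppose there is neither a red Qₘ nor a blue Qₙ.  If every set B ∪ S and every set ∁ (D ∪ S) with S
-- inside an n-set X is blue for ∣S∣ below l, respectively u, then Qₙ is mapped, with trace on X
-- the identity, by B ∪ S on its bottom l levels and by ∁ (D ∪ (X ─ S)) on its top u levels; each of
-- the n + 1 ∸ (l + u) levels between costs m new elements, since an interval of dimension m that is not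
-- entirely red contains a blue set.  Hence l + u ≤ y for a suitable y ≈ 4n/(m+2).
--
-- Applied with B = D = ∅ this yields red sets A and ∁ C with ∣A∣ + ∣C∣ ≤ y.  Applied with
-- B = A ∪ {t} and D = C ∪ {t′} it yields red sets A ∪ {t} ∪ Uₜ and ∁ (C ∪ {t} ∪ Vₜ) for all t in an
-- m-set Y, with ∣Uₜ∣ ≤ l, ∣Vₜ∣ ≤ u and l + u ≤ y.  These are the levels 0, 1, m - 1 and m of a red Qₘ
-- whose trace on Y is the identity.  A set on level 2 only has to contain two of the sets Uₜ and, if
-- it is on level m - 2, to avoid two of the sets Vₜ, so the levels 2, …, m - 2 cost only
-- (m - 3) n + 2 (l + u) elements altogether: an interval of dimension n contains a red set.
--
-- The sets Uₜ must be disjoint from the sets Vₜ.  They are sought in disjoint n-sets G₁ and G₂ with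
-- bounds l₁ + u₁ = y = l₂ + u₂; then l₁ + u₂ ≤ y or l₂ + u₁ ≤ y.

open import Defs
open import Data.Bool using (Bool; not)
import Data.Bool.Properties as Bool
open import Data.Fin using (Fin; zero; suc; _≟_)
open import Data.Fin.Subset
open import Data.Fin.Subset.Properties
open import Data.Nat using (ℕ; zero; suc; _+_; _*_; _∸_; _≤_; _<_; z≤n; s≤s; s≤s⁻¹; _≤?_; _<?_)
open import Data.Nat.DivMod using (_/_; _%_; m/n*n≤m; m≡m%n+[m/n]*n; m%n<n)
open import Data.Nat.Properties hiding (_≟_; _≤?_; _<?_)
open import Data.Nat.Tactic.RingSolver using (solve-∀)
open import Data.Product using (Σ; ∃; _×_; _,_; proj₁; proj₂)
open import Data.Sum as Sum using (_⊎_; inj₁; inj₂; [_,_]′; map₁)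
open import Data.Vec using ([]; _∷_; here; there)
open import Function using (_∘_; id; _∋_)
open import Function.Bundles using (mk⇔)
open import Relation.Nullary using (yes; no; contradiction; _×-dec_)
open import Relation.Binary.PropositionalEquality using (_≡_; _≢_; refl; sym; trans; cong; cong₂; subst)

private variable
  k N : ℕ
  p q r : Subset N
  x : Fin N

-- Elements and sizes of unions, differences and complements.

∪⁻ : x ∈ p ∪ q → x ∈ p ⊎ x ∈ q
∪⁻ = x∈p∪q⁻ _ _

∪ˡ : x ∈ p → x ∈ p ∪ q
∪ˡ = x∈p∪q⁺ ∘ inj₁

∪ʳ : x ∈ q → x ∈ p ∪ q
∪ʳ = x∈p∪q⁺ ∘ inj₂

∪-least : p ⊆ r → q ⊆ r → p ∪ q ⊆ r
∪-least p⊆r q⊆r = [ p⊆r , q⊆r ]′ ∘ ∪⁻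

∪-mono : ∀ {p p′ q q′ : Subset N} → p ⊆ p′ → q ⊆ q′ → p ∪ q ⊆ p′ ∪ q′
∪-mono p⊆p′ q⊆q′ = ∪-least (∪ˡ ∘ p⊆p′) (∪ʳ ∘ q⊆q′)

x∈p─q⇒x∈p : x ∈ p ─ q → x ∈ p
x∈p─q⇒x∈p = p─q⊆p _ _

x∈p─q⇒x∉q : ∀ (p q : Subset N) → x ∈ p ─ q → x ∉ q
x∈p─q⇒x∉q (_ ∷ p) (outside ∷ q) (there x∈) (there x∈q) = x∈p─q⇒x∉q p q x∈ x∈q
x∈p─q⇒x∉q (_ ∷ p) (inside  ∷ q) (there x∈) (there x∈q) = x∈p─q⇒x∉q p q x∈ x∈q

x∈∁[p∪q] : x ∉ p → x ∉ q → x ∈ ∁ (p ∪ q)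
x∈∁[p∪q] x∉p x∉q = x∉p⇒x∈∁p ([ x∉p , x∉q ]′ ∘ ∪⁻)

∣p∪q∣≡∣p∣+∣q─p∣ : ∀ (p q : Subset N) → ∣ p ∪ q ∣ ≡ ∣ p ∣ + ∣ q ─ p ∣
∣p∪q∣≡∣p∣+∣q─p∣ [] [] = refl
∣p∪q∣≡∣p∣+∣q─p∣ (inside ∷ p) (_ ∷ q) = cong suc (∣p∪q∣≡∣p∣+∣q─p∣ p q)
∣p∪q∣≡∣p∣+∣q─p∣ (outside ∷ p) (inside ∷ q) = trans (cong suc (∣p∪q∣≡∣p∣+∣q─p∣ p q)) (sym (+-suc _ _))
∣p∪q∣≡∣p∣+∣q─p∣ (outside ∷ p) (outside ∷ q) = ∣p∪q∣≡∣p∣+∣q─p∣ p q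

∣p∪q∣≤∣p∣+∣q∣ : ∀ (p q : Subset N) → ∣ p ∪ q ∣ ≤ ∣ p ∣ + ∣ q ∣
∣p∪q∣≤∣p∣+∣q∣ p q = ≤-trans (≤-reflexive (∣p∪q∣≡∣p∣+∣q─p∣ p q)) (+-monoʳ-≤ ∣ p ∣ (∣p─q∣≤∣p∣ q p))

∣q∣≤∣p∣+∣q─p∣ : ∀ (p q : Subset N) → ∣ q ∣ ≤ ∣ p ∣ + ∣ q ─ p ∣
∣q∣≤∣p∣+∣q─p∣ p q = ≤-trans (∣q∣≤∣p∪q∣ p q) (≤-reflexive (∣p∪q∣≡∣p∣+∣q─p∣ p q))

∣p∣+∣∁p∣≡n : ∀ (p : Subset N) → ∣ p ∣ + ∣ ∁ p ∣ ≡ N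
∣p∣+∣∁p∣≡n p = trans (cong (∣ p ∣ +_) (∣∁p∣≡n∸∣p∣ p)) (m+[n∸m]≡n (∣p∣≤n p))

Disjoint : Subset N → Subset N → Set
Disjoint p q = ∀ {x} → x ∈ p → x ∉ q

∣p∣+∣q∣≤∣p∪q∣ : ∀ (p q : Subset N) → Disjoint p q → ∣ p ∣ + ∣ q ∣ ≤ ∣ p ∪ q ∣
∣p∣+∣q∣≤∣p∪q∣ p q p∩q=∅ = ≤-trans
  (+-monoʳ-≤ ∣ p ∣ (p⊆q⇒∣p∣≤∣q∣ λ x∈q → x∈p∧x∉q⇒x∈p─q x∈q λ x∈p → p∩q=∅ x∈p x∈q))
  (≤-reflexive (sym (∣p∪q∣≡∣p∣+∣q─p∣ p q)))

p⊆q∧∣q∣≤∣p∣⇒p≡q : p ⊆ q → ∣ q ∣ ≤ ∣ p ∣ → p ≡ q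
p⊆q∧∣q∣≤∣p∣⇒p≡q {p = p} {q = q} p⊆q ∣q∣≤∣p∣ = ⊆-antisym p⊆q q⊆p
  where
  q⊆p : q ⊆ p
  q⊆p {x} x∈q with x ∈? p
  ... | yes x∈p = x∈p
  ... | no x∉p = contradiction (p⊂q⇒∣p∣<∣q∣ (p⊆q , x , x∈q , x∉p)) (≤⇒≯ ∣q∣≤∣p∣)

∣p∣≡0⇒p≡⊥ : ∣ p ∣ ≡ 0 → p ≡ ⊥
∣p∣≡0⇒p≡⊥ {N} eq = sym (p⊆q∧∣q∣≤∣p∣⇒p≡q (⊆-min _) (≤-reflexive (trans eq (sym (∣⊥∣≡0 N)))))

∣p∣≡1⇒p≡⁅x⁆ : ∀ (p : Subset N) → ∣ p ∣ ≡ 1 → ∃ λ x → p ≡ ⁅ x ⁆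
∣p∣≡1⇒p≡⁅x⁆ (inside ∷ p) eq = zero , cong (inside ∷_) (∣p∣≡0⇒p≡⊥ (suc-injective eq))
∣p∣≡1⇒p≡⁅x⁆ (outside ∷ p) eq with ∣p∣≡1⇒p≡⁅x⁆ p eq
... | x , refl = suc x , refl

-- Initial segments of a set, and coordinates on its subsets.

prefix : ℕ → Subset N → Subset N
prefix zero _ = ⊥
prefix (suc j) [] = []
prefix (suc j) (inside ∷ p) = inside ∷ prefix j p
prefix (suc j) (outside ∷ p) = outside ∷ prefix (suc j) p

prefix⊆ : ∀ j (p : Subset N) → prefix j p ⊆ p
prefix⊆ zero p x∈ = contradiction x∈ ∉⊥
prefix⊆ (suc j) (inside ∷ p) here = here
prefix⊆ (suc j) (inside ∷ p) (there x∈) = there (prefix⊆ j p x∈)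
prefix⊆ (suc j) (outside ∷ p) (there x∈) = there (prefix⊆ (suc j) p x∈)

prefix-mono : ∀ {i j} (p : Subset N) → i ≤ j → prefix i p ⊆ prefix j p
prefix-mono p z≤n x∈ = contradiction x∈ ∉⊥
prefix-mono (inside ∷ p) (s≤s i≤j) here = here
prefix-mono (inside ∷ p) (s≤s i≤j) (there x∈) = there (prefix-mono p i≤j x∈)
prefix-mono (outside ∷ p) (s≤s i≤j) (there x∈) = there (prefix-mono p (s≤s i≤j) x∈)

∣prefix∣ : ∀ j (p : Subset N) → j ≤ ∣ p ∣ → ∣ prefix j p ∣ ≡ j
∣prefix∣ {N} zero p _ = ∣⊥∣≡0 N
∣prefix∣ (suc j) (inside ∷ p) (s≤s j≤) = cong suc (∣prefix∣ j p j≤)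
∣prefix∣ (suc j) (outside ∷ p) j≤ = ∣prefix∣ (suc j) p j≤

-- The order isomorphism from `Q ∣ X ∣` onto the subsets of `X`.
expand : (X : Subset N) → Subset ∣ X ∣ → Subset N
expand [] [] = []
expand (inside ∷ X) (b ∷ A) = b ∷ expand X A
expand (outside ∷ X) A = outside ∷ expand X A

expand⊆ : ∀ (X : Subset N) A → expand X A ⊆ X
expand⊆ (inside ∷ X) (_ ∷ A) here = here
expand⊆ (inside ∷ X) (_ ∷ A) (there x∈) = there (expand⊆ X A x∈)
expand⊆ (outside ∷ X) A (there x∈) = there (expand⊆ X A x∈)

expand-mono : ∀ (X : Subset N) {A B} → A ⊆ B → expand X A ⊆ expand X B
expand-mono (inside ∷ X) {_ ∷ A} {_ ∷ B} A⊆B here with A⊆B here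
... | here = here
expand-mono (inside ∷ X) {_ ∷ A} {_ ∷ B} A⊆B (there x∈) = there (expand-mono X (drop-∷-⊆ A⊆B) x∈)
expand-mono (outside ∷ X) A⊆B (there x∈) = there (expand-mono X A⊆B x∈)

expand-reflect : ∀ (X : Subset N) {A B} → expand X A ⊆ expand X B → A ⊆ B
expand-reflect (inside ∷ X) {_ ∷ A} {_ ∷ B} h here with h here
... | here = here
expand-reflect (inside ∷ X) {_ ∷ A} {_ ∷ B} h (there x∈) = there (expand-reflect X (drop-∷-⊆ h) x∈)
expand-reflect (outside ∷ X) h x∈ = expand-reflect X (drop-∷-⊆ h) x∈

all-or : {P : Subset N → Set} {R : Set} → (∀ S → P S ⊎ R) → (∀ S → P S) ⊎ R
all-or {zero} h = map₁ (λ { P[] [] → P[] }) (h [])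
all-or {suc N} h with all-or (h ∘ (inside ∷_)) | all-or (h ∘ (outside ∷_))
... | inj₂ r | _ = inj₂ r
... | inj₁ _ | inj₂ r = inj₂ r
... | inj₁ i | inj₁ o = inj₁ λ { (inside ∷ S) → i S ; (outside ∷ S) → o S }

-- Copies chosen from a family of intervals.

Coloring : ℕ → Set
Coloring N = Q N → Bool

Copy : Coloring N → Bool → ℕ → Set
Copy {N} c col k = Σ (Q k → Q N) λ f → IsCopy f × (∀ A → c (f A) ≡ col)

Between : Coloring N → Bool → Subset N → Subset N → Set
Between c col L H = ∃ λ F → L ⊆ F × F ⊆ H × c F ≡ col

exactly : ∀ {c : Coloring N} {col} F → c F ≡ col → Between c col F F
exactly F eq = F , id , id , eq

-- One set of colour `col` is chosen between `lo S` and `hi S` for each `S`. The interval of `S`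
-- ends below that of any larger `T`, so the choice is monotone; the last two hypotheses give the
-- chosen set the trace `S` on `X`, so the order is also reflected.
interval-copy : {R : Set} (c : Coloring N) (col : Bool) (X : Subset N) → ∣ X ∣ ≡ k → (lo hi : Subset N → Subset N) →
  (∀ S → S ⊆ X → Between c col (lo S) (hi S) ⊎ R) →
  (∀ {S T} → S ⊆ X → T ⊆ X → S ⊆ T → ∣ S ∣ < ∣ T ∣ → hi S ⊆ lo T) →
  (∀ {S} → S ⊆ X → S ⊆ lo S) →
  (∀ {S x} → S ⊆ X → x ∈ hi S → x ∈ X → x ∈ S) →
  Copy c col k ⊎ R
interval-copy {N = N} {R = R} c col X refl lo hi choice step S⊆lo hi∩X⊆ = map₁ build (all-or choice′)
  where
  choice′ : ∀ S → (S ⊆ X → Between c col (lo S) (hi S)) ⊎ R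
  choice′ S with S ⊆? X
  ... | yes S⊆X = map₁ (λ b _ → b) (choice S S⊆X)
  -- `all-or` runs over all subsets of the ground set; for those outside `X` the conditional
  -- statement is vacuous.
  ... | no S⊈X = inj₁ λ S⊆X → contradiction (λ {x} → S⊆X {x}) S⊈X

  build : (∀ S → S ⊆ X → Between c col (lo S) (hi S)) → Copy c col ∣ X ∣
  build g = f , (λ A B → mk⇔ (f-mono A B) (f-reflect A B)) , λ A → proj₂ (proj₂ (proj₂ (gA A)))
    where
    e : Q ∣ X ∣ → Subset N
    e = expand X

    e⊆ : ∀ A → e A ⊆ X
    e⊆ = expand⊆ X

    gA : ∀ A → Between c col (lo (e A)) (hi (e A))
    gA A = g (e A) (e⊆ A)

    f : Q ∣ X ∣ → Subset N
    f A = proj₁ (gA A)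

    f-mono : ∀ A B → A ⊆ B → f A ⊆ f B
    f-mono A B A⊆B with ∣ e A ∣ <? ∣ e B ∣
    ... | yes A<B = λ x∈ → proj₁ (proj₂ (gA B)) (step (e⊆ A) (e⊆ B) (expand-mono X A⊆B) A<B (proj₁ (proj₂ (proj₂ (gA A))) x∈))
    ... | no A≮B = ⊆-reflexive (cong f (⊆-antisym A⊆B (expand-reflect X (⊆-reflexive (sym eA≡eB)))))
      where
      eA≡eB : e A ≡ e B
      eA≡eB = p⊆q∧∣q∣≤∣p∣⇒p≡q (expand-mono X A⊆B) (≮⇒≥ A≮B)

    f-reflect : ∀ A B → f A ⊆ f B → A ⊆ B
    f-reflect A B fA⊆fB = expand-reflect X λ x∈ →
      hi∩X⊆ (e⊆ B) (proj₁ (proj₂ (proj₂ (gA B))) (fA⊆fB (proj₁ (proj₂ (gA A)) (S⊆lo (e⊆ A) x∈)))) (e⊆ A x∈)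

-- If colour `col` is missing from the interval, then `L ∪ S` has the other colour for every `S`
-- inside a fixed `k`-subset of `H ─ L`.
window : ∀ (c : Coloring N) col (L H : Subset N) → L ⊆ H → k ≤ ∣ H ─ L ∣ →
  Between c col L H ⊎ Copy c (not col) k
window {k = k} c col L H L⊆H k≤ with anySubset? (λ F → (L ⊆? F) ×-dec (F ⊆? H) ×-dec (c F Bool.≟ col))
... | yes found = inj₁ found
... | no none = Sum.swap (interval-copy c (not col) K (∣prefix∣ k (H ─ L) k≤) (L ∪_) (L ∪_) choice
    (λ _ _ S⊆T _ → ∪-mono id S⊆T) (λ _ → ∪ʳ) inK)
  where
  K = prefix k (H ─ L)

  K⊆ : K ⊆ H ─ L
  K⊆ = prefix⊆ k (H ─ L)

  choice : ∀ S → S ⊆ K → Between c (not col) (L ∪ S) (L ∪ S) ⊎ Between c col L H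
  choice S S⊆K = inj₁ (exactly (L ∪ S) (Bool.¬-not λ eq →
    none (L ∪ S , ∪ˡ , ∪-least L⊆H (λ x∈ → x∈p─q⇒x∈p (K⊆ (S⊆K x∈))) , eq)))

  inK : ∀ {S x} → S ⊆ K → x ∈ L ∪ S → x ∈ K → x ∈ S
  inK _ x∈ x∈K with ∪⁻ x∈
  ... | inj₁ x∈L = contradiction x∈L (x∈p─q⇒x∉q _ _ (K⊆ x∈K))
  ... | inj₂ x∈S = x∈S

-- With `c ∘ ∁` in place of `c` this speaks of the sets `∁ (B ∪ S)`, so that one notion serves both
-- ends of the lattice.
Flat : Coloring N → Subset N → Subset N → ℕ → Set
Flat c B G l = ∀ S → S ⊆ G → ∣ S ∣ < l → c (B ∪ S) ≡ Blue

RedWithin : Coloring N → Subset N → Subset N → ℕ → Set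
RedWithin c B G l = ∃ λ S → S ⊆ G × ∣ S ∣ < l × c (B ∪ S) ≡ Red

flat-or-red : ∀ (c : Coloring N) B G l → Flat c B G l ⊎ RedWithin c B G l
flat-or-red c B G l with anySubset? (λ S → (S ⊆? G) ×-dec (∣ S ∣ <? l) ×-dec (c (B ∪ S) Bool.≟ Red))
... | yes red = inj₂ red
... | no ¬red = inj₁ λ S S⊆G S<l → Bool.¬-not λ eq → ¬red (S , (λ {x} → S⊆G {x}) , S<l , eq)

-- A blue lattice between two flat ends.

module FlatEnds {N m n : ℕ} (c : Coloring N) (B D X : Subset N) (l u : ℕ)
  (∣X∣≡n : ∣ X ∣ ≡ n) (B∩X : Disjoint B X) (D∩X : Disjoint D X) (B∩D : Disjoint B D)
  (low : Flat c B X l) (high : Flat (c ∘ ∁) D X u) (l+u≤n : l + u ≤ n)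
  (room : m * (n + 1 ∸ (l + u)) ≤ ∣ ∁ (X ∪ B ∪ D) ∣) where

  R : Subset N
  R = ∁ (X ∪ B ∪ D)

  x∉X∪B∪D : x ∈ R → x ∉ X × x ∉ B × x ∉ D
  x∉X∪B∪D x∈R = x∉ ∘ ∪ˡ , x∉ ∘ ∪ʳ ∘ ∪ˡ , x∉ ∘ ∪ʳ ∘ ∪ʳ
    where x∉ = x∈∁p⇒x∉p x∈R

  -- Empty for i ≤ l, by truncated subtraction.
  R≤ : ℕ → Subset N
  R≤ i = prefix ((i ∸ l) * m) R

  x∉X∪B∪D′ : ∀ i → x ∈ R≤ i → x ∉ X × x ∉ B × x ∉ D
  x∉X∪B∪D′ i = x∉X∪B∪D ∘ prefix⊆ ((i ∸ l) * m) R

  bottom : Subset N → ℕ → Subset N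
  bottom S i = B ∪ S ∪ R≤ i

  top : Subset N → Subset N
  top S = ∁ (D ∪ (X ─ S))

  -- The test `n < ∣ S ∣ + u` says that `X ─ S` has fewer than `u` elements; there the interval is
  -- the single set `top S`. Below, `hi` on one level and `lo` on the next use the same part of the
  -- reservoir `R`.
  lo hi : Subset N → Subset N
  lo S with n <? ∣ S ∣ + u
  ... | yes _ = top S
  ... | no _ = bottom S ∣ S ∣
  hi S with n <? ∣ S ∣ + u
  ... | yes _ = top S
  ... | no _ = bottom S (suc ∣ S ∣)

  bottom-mono : ∀ {S T i j} → S ⊆ T → i ≤ j → bottom S i ⊆ bottom T j
  bottom-mono S⊆T i≤j = ∪-mono id (∪-mono S⊆T (prefix-mono R (*-monoˡ-≤ m (∸-monoˡ-≤ l i≤j))))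

  bottom⊆top : ∀ {S T} i → S ⊆ X → S ⊆ T → bottom S i ⊆ top T
  bottom⊆top i S⊆X S⊆T = ∪-least
    (λ x∈B → x∈∁[p∪q] (B∩D x∈B) (B∩X x∈B ∘ x∈p─q⇒x∈p))
    (∪-least
      (λ x∈S → x∈∁[p∪q] (λ x∈D → D∩X x∈D (S⊆X x∈S)) (λ x∈ → x∈p─q⇒x∉q _ _ x∈ (S⊆T x∈S)))
      (λ x∈R → let (x∉X , _ , x∉D) = x∉X∪B∪D′ i x∈R in x∈∁[p∪q] x∉D (x∉X ∘ x∈p─q⇒x∈p)))

  top-mono : ∀ {S T} → S ⊆ T → top S ⊆ top T
  top-mono S⊆T = p⊆q⇒∁p⊇∁q (∪-mono id λ x∈ → x∈p∧x∉q⇒x∈p─q (x∈p─q⇒x∈p x∈) (x∈p─q⇒x∉q _ _ x∈ ∘ S⊆T))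

  step : ∀ {S T} → S ⊆ X → T ⊆ X → S ⊆ T → ∣ S ∣ < ∣ T ∣ → hi S ⊆ lo T
  step {S} {T} S⊆X T⊆X S⊆T S<T with n <? ∣ S ∣ + u | n <? ∣ T ∣ + u
  ... | yes _ | yes _ = top-mono S⊆T
  ... | yes a | no b = contradiction (<-≤-trans a (+-monoˡ-≤ u (<⇒≤ S<T))) b
  ... | no _ | yes _ = bottom⊆top (suc ∣ S ∣) S⊆X S⊆T
  ... | no _ | no _ = bottom-mono S⊆T S<T

  S⊆lo : ∀ {S} → S ⊆ X → S ⊆ lo S
  S⊆lo {S} S⊆X with n <? ∣ S ∣ + u
  ... | yes _ = bottom⊆top 0 S⊆X id ∘ ∪ʳ ∘ ∪ˡ
  ... | no _ = ∪ʳ ∘ ∪ˡ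

  hi∩X⊆ : ∀ {S x} → S ⊆ X → x ∈ hi S → x ∈ X → x ∈ S
  hi∩X⊆ {S} {x} S⊆X x∈hi x∈X with n <? ∣ S ∣ + u
  hi∩X⊆ {S} {x} S⊆X x∈hi x∈X | yes _ with x ∈? S
  ... | yes x∈S = x∈S
  ... | no x∉S = contradiction (∪ʳ (x∈p∧x∉q⇒x∈p─q x∈X x∉S)) (x∈∁p⇒x∉p x∈hi)
  hi∩X⊆ {S} {x} S⊆X x∈hi x∈X | no _ with ∪⁻ x∈hi
  ... | inj₁ x∈B = contradiction x∈X (B∩X x∈B)
  ... | inj₂ x∈′ with ∪⁻ x∈′
  ...   | inj₁ x∈S = x∈S
  ...   | inj₂ x∈R = contradiction x∈X (proj₁ (x∉X∪B∪D′ (suc ∣ S ∣) x∈R))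

  -- The levels from `l` to `n ∸ u` use one block of `m` elements each, and `room` pays for all
  -- these blocks.
  mid-room : ∀ i → l ≤ i → i + u ≤ n → (suc i ∸ l) * m ≤ ∣ R ∣
  mid-room i l≤i i+u≤n = begin
    (suc i ∸ l) * m              ≡⟨ *-comm (suc i ∸ l) m ⟩
    m * (suc i ∸ l)              ≡⟨ cong (m *_) (sym ([m+n]∸[m+o]≡n∸o u (suc i) l)) ⟩
    m * (u + suc i ∸ (u + l))    ≡⟨ cong₂ (λ a b → m * (a ∸ b)) (trans (+-comm u (suc i)) (+-comm 1 (i + u))) (+-comm u l) ⟩
    m * (i + u + 1 ∸ (l + u))    ≤⟨ *-monoʳ-≤ m (∸-monoˡ-≤ (l + u) (+-monoˡ-≤ 1 i+u≤n)) ⟩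
    m * (n + 1 ∸ (l + u))        ≤⟨ room ⟩
    ∣ R ∣                        ∎
    where open ≤-Reasoning

  -- The `m` elements by which `R≤` grows lie outside `X` and `B`, so none of them is in
  -- `bottom S ∣ S ∣`.
  mid-width : ∀ S → S ⊆ X → l ≤ ∣ S ∣ → ∣ S ∣ + u ≤ n → m ≤ ∣ bottom S (suc ∣ S ∣) ─ bottom S ∣ S ∣ ∣
  mid-width S S⊆X l≤S S+u≤n = ≤-trans width (p⊆q⇒∣p∣≤∣q∣ new)
    where
    i = ∣ S ∣
    room′ = mid-room i l≤S S+u≤n
    i∸l< : suc i ∸ l ≡ suc (i ∸ l)
    i∸l< = +-∸-assoc 1 l≤S

    width : m ≤ ∣ R≤ (suc i) ─ R≤ i ∣
    width = +-cancelˡ-≤ ((i ∸ l) * m) _ _ (begin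
      (i ∸ l) * m + m                    ≡⟨ +-comm _ m ⟩
      suc (i ∸ l) * m                    ≡⟨ cong (_* m) (sym i∸l<) ⟩
      (suc i ∸ l) * m                    ≡⟨ sym (∣prefix∣ _ R room′) ⟩
      ∣ R≤ (suc i) ∣                     ≤⟨ ∣q∣≤∣p∣+∣q─p∣ (R≤ i) (R≤ (suc i)) ⟩
      ∣ R≤ i ∣ + ∣ R≤ (suc i) ─ R≤ i ∣    ≡⟨ cong (_+ ∣ R≤ (suc i) ─ R≤ i ∣) (∣prefix∣ _ R (≤-trans (*-monoˡ-≤ m (∸-monoˡ-≤ l (n≤1+n i))) room′)) ⟩
      (i ∸ l) * m + ∣ R≤ (suc i) ─ R≤ i ∣ ∎)
      where open ≤-Reasoning

    new : R≤ (suc i) ─ R≤ i ⊆ bottom S (suc i) ─ bottom S i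
    new x∈ = x∈p∧x∉q⇒x∈p─q (∪ʳ (∪ʳ x∈R′)) ([ proj₁ (proj₂ out) , [ (λ x∈S → proj₁ out (S⊆X x∈S)) , x∈p─q⇒x∉q _ _ x∈ ]′ ∘ ∪⁻ ]′ ∘ ∪⁻)
      where
      x∈R′ = x∈p─q⇒x∈p x∈
      out = x∉X∪B∪D′ (suc i) x∈R′

  choice : ∀ S → S ⊆ X → Between c Blue (lo S) (hi S) ⊎ Copy c Red m
  choice S S⊆X with n <? ∣ S ∣ + u
  ... | yes n<S+u = inj₁ (exactly (top S) (high (X ─ S) x∈p─q⇒x∈p short))
    where
    short : ∣ X ─ S ∣ < u
    short = +-cancelˡ-< ∣ S ∣ _ _ (≤-<-trans (≤-trans (∣p∣+∣q∣≤∣p∪q∣ S (X ─ S) λ x∈S x∈ → x∈p─q⇒x∉q _ _ x∈ x∈S)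
      (≤-trans (p⊆q⇒∣p∣≤∣q∣ (∪-least {q = X ─ S} S⊆X x∈p─q⇒x∈p)) (≤-reflexive ∣X∣≡n))) n<S+u)
  ... | no n≮S+u with ∣ S ∣ <? l
  -- Below level `l` no block has been used yet, so `lo S` is just `B ∪ S`, which is blue by `low`.
  ...   | yes S<l = inj₁ (B ∪ S , ∪-mono id (∪-least id empty) , ∪-mono id ∪ˡ , low S S⊆X S<l)
    where
    empty : R≤ ∣ S ∣ ⊆ S
    empty x∈ rewrite m≤n⇒m∸n≡0 (<⇒≤ S<l) = contradiction x∈ ∉⊥
  ...   | no S≮l = window c Blue (bottom S ∣ S ∣) (bottom S (suc ∣ S ∣)) (bottom-mono id (n≤1+n ∣ S ∣))
    (mid-width S S⊆X (≮⇒≥ S≮l) (≮⇒≥ n≮S+u))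

  copy : Copy c Blue n ⊎ Copy c Red m
  copy = interval-copy c Blue X ∣X∣≡n lo hi choice step S⊆lo hi∩X⊆

-- Indexed unions, and two extreme levels of a red lattice.

∣prefix∣≤ : ∀ j (p : Subset N) → ∣ prefix j p ∣ ≤ j
∣prefix∣≤ {N} zero p = ≤-reflexive (∣⊥∣≡0 N)
∣prefix∣≤ (suc j) [] = z≤n
∣prefix∣≤ (suc j) (inside ∷ p) = s≤s (∣prefix∣≤ j p)
∣prefix∣≤ (suc j) (outside ∷ p) = ∣prefix∣≤ (suc j) p

union : Subset k → (Fin k → Subset N) → Subset N
union [] U = ⊥
union (inside ∷ T) U = U zero ∪ union T (U ∘ suc)
union (outside ∷ T) U = union T (U ∘ suc)

x∈union⁺ : ∀ {T : Subset k} {t} (U : Fin k → Subset N) → t ∈ T → U t ⊆ union T U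
x∈union⁺ {T = inside ∷ T} U here = ∪ˡ
x∈union⁺ {T = inside ∷ T} U (there t∈T) = ∪ʳ ∘ x∈union⁺ (U ∘ suc) t∈T
x∈union⁺ {T = outside ∷ T} U (there t∈T) = x∈union⁺ (U ∘ suc) t∈T

x∈union⁻ : ∀ (T : Subset k) (U : Fin k → Subset N) → x ∈ union T U → ∃ λ t → t ∈ T × x ∈ U t
x∈union⁻ [] U x∈ = contradiction x∈ ∉⊥
x∈union⁻ (inside ∷ T) U x∈ with ∪⁻ x∈
... | inj₁ x∈U = zero , here , x∈U
... | inj₂ x∈′ with x∈union⁻ T (U ∘ suc) x∈′
...   | t , t∈T , x∈U = suc t , there t∈T , x∈U
x∈union⁻ (outside ∷ T) U x∈ with x∈union⁻ T (U ∘ suc) x∈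
... | t , t∈T , x∈U = suc t , there t∈T , x∈U

union-mono : ∀ {S T : Subset k} (U : Fin k → Subset N) → S ⊆ T → union S U ⊆ union T U
union-mono {S = S} U S⊆T x∈ with x∈union⁻ S U x∈
... | t , t∈S , x∈U = x∈union⁺ U (S⊆T t∈S) x∈U

union-least : ∀ (T : Subset k) {U : Fin k → Subset N} → (∀ t → U t ⊆ r) → union T U ⊆ r
union-least T {U} U⊆ x∈ with x∈union⁻ T U x∈
... | t , _ , x∈U = U⊆ t x∈U

union-⁅⁆ : ∀ (U : Fin k → Subset N) t → union ⁅ t ⁆ U ≡ U t
union-⁅⁆ U t = ⊆-antisym union⊆ (x∈union⁺ U (x∈⁅x⁆ t))
  where
  union⊆ : union ⁅ t ⁆ U ⊆ U t
  union⊆ x∈ with x∈union⁻ ⁅ t ⁆ U x∈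
  ... | s , s∈ , x∈U rewrite x∈⁅y⁆⇒x≡y t s∈ = x∈U

∣union∣≤ : ∀ (T : Subset k) (U : Fin k → Subset N) l → (∀ t → ∣ U t ∣ ≤ l) → ∣ union T U ∣ ≤ ∣ T ∣ * l
∣union∣≤ {N = N} [] U l U≤ = ≤-reflexive (∣⊥∣≡0 N)
∣union∣≤ (inside ∷ T) U l U≤ = ≤-trans (∣p∪q∣≤∣p∣+∣q∣ (U zero) _) (+-mono-≤ (U≤ zero) (∣union∣≤ T (U ∘ suc) l (U≤ ∘ suc)))
∣union∣≤ (outside ∷ T) U l U≤ = ∣union∣≤ T (U ∘ suc) l (U≤ ∘ suc)

-- Levels 0 and 1 of a red lattice with trace on `Y`; for `c ∘ ∁` the complements form its two
-- highest levels. `U` is total, and bounded everywhere, so that unions need no membership proofs.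
record Fan (c : Coloring N) (B Y G : Subset N) (l : ℕ) : Set where
  field
    U       : Fin N → Subset N
    U⊆G     : ∀ t → U t ⊆ G
    ∣U∣≤l   : ∀ t → ∣ U t ∣ ≤ l
    root    : c B ≡ Red
    leaf    : ∀ {t} → t ∈ Y → c ((B ∪ ⁅ t ⁆) ∪ U t) ≡ Red

  fan : Subset N → Subset N
  fan T = (B ∪ T) ∪ union T U

  -- For empty `T` the union vanishes and `root` applies; for a singleton it is one set `U t` and
  -- `leaf` applies.
  fan-red : ∀ {T} → T ⊆ Y → ∣ T ∣ ≤ 1 → c (fan T) ≡ Red
  fan-red {T} T⊆Y ∣T∣≤1 with m≤n⇒m<n∨m≡n ∣T∣≤1
  ... | inj₂ ∣T∣≡1 with ∣p∣≡1⇒p≡⁅x⁆ T ∣T∣≡1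
  ...   | t , refl = trans (cong (λ Z → c ((B ∪ ⁅ t ⁆) ∪ Z)) (union-⁅⁆ U t)) (leaf (T⊆Y (x∈⁅x⁆ t)))
  fan-red {T} T⊆Y ∣T∣≤1 | inj₁ (s≤s ∣T∣≤0) with ∣p∣≡0⇒p≡⊥ {p = T} (n≤0⇒n≡0 ∣T∣≤0)
  ... | refl = trans (cong c (⊆-antisym fan⊆B (∪ˡ ∘ ∪ˡ))) root
    where
    fan⊆B : fan ⊥ ⊆ B
    fan⊆B = ∪-least (∪-least id (⊆-min B)) λ x∈ → contradiction (proj₁ (proj₂ (x∈union⁻ ⊥ U x∈))) ∉⊥

red-within⇒fan : ∀ (c : Coloring N) B Y G l → c B ≡ Red → (∀ {t} → t ∈ Y → RedWithin c (B ∪ ⁅ t ⁆) G (suc l)) → Fan c B Y G l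
red-within⇒fan {N = N} c B Y G l B-red red = record
  { U = U ; U⊆G = U⊆G ; ∣U∣≤l = ∣U∣≤l ; root = B-red ; leaf = leaf }
  where
  U : Fin N → Subset N
  U t with t ∈? Y
  ... | yes t∈Y = proj₁ (red t∈Y)
  -- Default outside `Y`: the empty set meets the inclusion in `G` and the size bound.
  ... | no _ = ⊥

  U⊆G : ∀ t → U t ⊆ G
  U⊆G t with t ∈? Y
  ... | yes t∈Y = proj₁ (proj₂ (red t∈Y))
  ... | no _ = ⊆-min G

  ∣U∣≤l : ∀ t → ∣ U t ∣ ≤ l
  ∣U∣≤l t with t ∈? Y
  ... | yes t∈Y = s≤s⁻¹ (proj₁ (proj₂ (proj₂ (red t∈Y))))
  ... | no _ = ≤-trans (≤-reflexive (∣⊥∣≡0 N)) z≤n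

  leaf : ∀ {t} → t ∈ Y → c ((B ∪ ⁅ t ⁆) ∪ U t) ≡ Red
  leaf {t} t∈Y with t ∈? Y
  ... | yes t∈Y′ = proj₂ (proj₂ (proj₂ (red t∈Y′)))
  ... | no t∉Y = contradiction t∈Y t∉Y

-- A red lattice between a lower and an upper fan.

module TwoFans {N m n : ℕ} (c : Coloring N) (A C Y G₁ G₂ : Subset N) (l u : ℕ)
  (∣Y∣≡m : ∣ Y ∣ ≡ m) (A∩Y : Disjoint A Y) (C∩Y : Disjoint C Y) (A∩C : Disjoint A C)
  (G₁⊆W : G₁ ⊆ ∁ (Y ∪ A ∪ C)) (G₂⊆W : G₂ ⊆ ∁ (Y ∪ A ∪ C)) (G₁∩G₂ : Disjoint G₁ G₂)
  (∣G₁∣≡n : ∣ G₁ ∣ ≡ n) (∣G₂∣≡n : ∣ G₂ ∣ ≡ n)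
  (lower : Fan c A Y G₁ l) (upper : Fan (c ∘ ∁) C Y G₂ u)
  (room : (m ∸ 3) * n + 2 * (l + u) ≤ ∣ ∁ (Y ∪ A ∪ C) ∣) where

  open Fan lower renaming (fan to low; fan-red to low-red; ∣U∣≤l to ∣U∣≤; U⊆G to U⊆G₁) using (U)
  open Fan upper renaming (fan to cofan; fan-red to cofan-red; U to V; ∣U∣≤l to ∣V∣≤; U⊆G to V⊆G₂) using ()

  W H : Subset N
  W = ∁ (Y ∪ A ∪ C)
  H = W ─ (G₁ ∪ G₂)

  W∩ : x ∈ W → x ∉ Y × x ∉ A × x ∉ C
  W∩ x∈W = x∉ ∘ ∪ˡ , x∉ ∘ ∪ʳ ∘ ∪ˡ , x∉ ∘ ∪ʳ ∘ ∪ʳ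
    where x∉ = x∈∁p⇒x∉p x∈W

  UT⊆G₁ : ∀ T → union T U ⊆ G₁
  UT⊆G₁ T = union-least T U⊆G₁

  VT⊆G₂ : ∀ T → union T V ⊆ G₂
  VT⊆G₂ T = union-least T V⊆G₂

  H⊆W : H ⊆ W
  H⊆W = x∈p─q⇒x∈p

  H∩G : x ∈ H → x ∉ G₁ × x ∉ G₂
  H∩G x∈H = x∉ ∘ ∪ˡ , x∉ ∘ ∪ʳ
    where x∉ = x∈p─q⇒x∉q W _ x∈H

  -- For 2 ≤ i ≤ m - 2 the sets on level i contain E i and, outside A ∪ Y, lie in E (suc i).
  -- As E 2 is empty, level 2 sits above the sets U only and can still use the rest of G₁.
  E : ℕ → Subset N
  E (suc (suc (suc j))) with m ≤? 4 + j
  ... | yes _ = W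
  ... | no _ = G₁ ∪ prefix (2 * l + j * n) H
  E _ = ⊥

  G₁⊆E : ∀ j → G₁ ⊆ E (3 + j)
  G₁⊆E j with m ≤? 4 + j
  ... | yes _ = G₁⊆W
  ... | no _ = ∪ˡ

  E⊆W : ∀ i → E i ⊆ W
  E⊆W 0 = ⊆-min W
  E⊆W 1 = ⊆-min W
  E⊆W 2 = ⊆-min W
  E⊆W (suc (suc (suc j))) with m ≤? 4 + j
  ... | yes _ = id
  ... | no _ = ∪-least G₁⊆W (H⊆W ∘ prefix⊆ (2 * l + j * n) H)

  E-mono : ∀ {i j} → i ≤ j → E i ⊆ E j
  E-mono {0} {j} _ = ⊆-min (E j)
  E-mono {1} {j} _ = ⊆-min (E j)
  E-mono {2} {j} _ = ⊆-min (E j)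
  E-mono {suc (suc (suc i))} {suc (suc (suc j))} (s≤s (s≤s (s≤s i≤j))) with m ≤? 4 + i | m ≤? 4 + j
  ... | yes _ | yes _ = id
  ... | yes a | no b = contradiction (≤-trans a (+-monoʳ-≤ 4 i≤j)) b
  ... | no _ | yes _ = ∪-least G₁⊆W (H⊆W ∘ prefix⊆ (2 * l + i * n) H)
  ... | no _ | no _ = ∪-mono id (prefix-mono H (+-monoʳ-≤ (2 * l) (*-monoˡ-≤ n i≤j)))

  E∩G₂ : ∀ {i} → suc i < m → Disjoint (E i) G₂
  E∩G₂ {0} _ x∈ = contradiction x∈ ∉⊥
  E∩G₂ {1} _ x∈ = contradiction x∈ ∉⊥
  E∩G₂ {2} _ x∈ = contradiction x∈ ∉⊥
  E∩G₂ {suc (suc (suc j))} <m x∈ x∈G₂ with m ≤? 4 + j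
  ... | yes m≤ = contradiction m≤ (<⇒≱ <m)
  ... | no _ = [ (λ x∈G₁ → G₁∩G₂ x∈G₁ x∈G₂) , (λ x∈ → proj₂ (H∩G (prefix⊆ (2 * l + j * n) H x∈)) x∈G₂) ]′ (∪⁻ x∈)

  -- `bottom` must contain the sets `U t` of levels 0 and 1 below it; `middle` must avoid `V t` for
  -- `t` outside `T`, since the sets `top` above it may omit these.
  bottom middle : Subset N → ℕ → Subset N
  bottom T i = (A ∪ T) ∪ (union T U ∪ E i)
  middle T i = (A ∪ T) ∪ (E (suc i) ─ union (Y ─ T) V)

  top : Subset N → Subset N
  top T = ∁ (cofan (Y ─ T))

  -- Levels from `m ∸ 1` on carry complements of the upper fan. On levels 0 and 1 `E` is empty, so
  -- both ends of the interval are `low T`. Only the levels between have proper intervals.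
  lo hi : Subset N → Subset N
  lo T with m ≤? suc ∣ T ∣
  ... | yes _ = top T
  ... | no _ = bottom T ∣ T ∣
  hi T with m ≤? suc ∣ T ∣ | ∣ T ∣ <? 2
  ... | yes _ | _ = top T
  ... | no _ | yes _ = low T
  ... | no _ | no _ = middle T ∣ T ∣

  -- The complement of `top T` consists of `C`, `Y ─ T` and the sets `V t` with `t` in `Y ─ T`. As
  -- `Z` lies in `W`, only the last could meet it.
  below-top : ∀ {S T Z} → S ⊆ Y → S ⊆ T → Z ⊆ W → Disjoint Z (union (Y ─ T) V) → (A ∪ S) ∪ Z ⊆ top T
  below-top {S} {T} {Z} S⊆Y S⊆T Z⊆W Z∩V = ∪-least (∪-least A⊆ S⊆) Z⊆
    where
    V⊆W : union (Y ─ T) V ⊆ W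
    V⊆W x∈ = G₂⊆W (VT⊆G₂ (Y ─ T) x∈)

    A⊆ : A ⊆ top T
    A⊆ x∈A = x∈∁[p∪q] ([ A∩C x∈A , A∩Y x∈A ∘ x∈p─q⇒x∈p ]′ ∘ ∪⁻) (λ x∈ → proj₁ (proj₂ (W∩ (V⊆W x∈))) x∈A)

    S⊆ : S ⊆ top T
    S⊆ x∈S = x∈∁[p∪q] ([ (λ x∈C → C∩Y x∈C (S⊆Y x∈S)) , (λ x∈ → x∈p─q⇒x∉q Y T x∈ (S⊆T x∈S)) ]′ ∘ ∪⁻)
      (λ x∈ → proj₁ (W∩ (V⊆W x∈)) (S⊆Y x∈S))

    Z⊆ : Z ⊆ top T
    Z⊆ x∈Z = let (x∉Y , _ , x∉C) = W∩ (Z⊆W x∈Z) in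
      x∈∁[p∪q] ([ x∉C , x∉Y ∘ x∈p─q⇒x∈p ]′ ∘ ∪⁻) (Z∩V x∈Z)

  Y─-anti : ∀ {S T} → S ⊆ T → Y ─ T ⊆ Y ─ S
  Y─-anti {S} {T} S⊆T x∈ = x∈p∧x∉q⇒x∈p─q (x∈p─q⇒x∈p x∈) (x∈p─q⇒x∉q Y T x∈ ∘ S⊆T)

  UT∩V : ∀ S T → Disjoint (union S U) (union T V)
  UT∩V S T x∈U x∈V = G₁∩G₂ (UT⊆G₁ S x∈U) (VT⊆G₂ T x∈V)

  UT⊆W : ∀ S → union S U ⊆ W
  UT⊆W S x∈ = G₁⊆W (UT⊆G₁ S x∈)

  step : ∀ {S T} → S ⊆ Y → T ⊆ Y → S ⊆ T → ∣ S ∣ < ∣ T ∣ → hi S ⊆ lo T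
  step {S} {T} S⊆Y T⊆Y S⊆T S<T with m ≤? suc ∣ S ∣ | ∣ S ∣ <? 2 | m ≤? suc ∣ T ∣
  ... | yes _ | _ | yes _ = p⊆q⇒∁p⊇∁q (∪-mono (∪-mono id (Y─-anti S⊆T)) (union-mono V (Y─-anti S⊆T)))
  ... | yes a | _ | no b = contradiction (≤-trans a (s≤s (<⇒≤ S<T))) b
  ... | no _ | yes _ | yes _ = below-top S⊆Y S⊆T (UT⊆W S) (UT∩V S (Y ─ T))
  ... | no _ | yes _ | no _ = ∪-mono (∪-mono id S⊆T) (∪ˡ ∘ union-mono U S⊆T)
  -- `middle S` has lost `V t` for all `t` in `Y ─ S`, which includes all `t` in `Y ─ T`.
  ... | no _ | no _ | yes _ = below-top S⊆Y S⊆T (E⊆W (suc ∣ S ∣) ∘ x∈p─q⇒x∈p)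
      (λ x∈ x∈V → x∈p─q⇒x∉q (E (suc ∣ S ∣)) _ x∈ (union-mono V (Y─-anti S⊆T) x∈V))
  ... | no _ | no _ | no _ = ∪-mono (∪-mono id S⊆T) (∪ʳ ∘ E-mono S<T ∘ x∈p─q⇒x∈p)

  S⊆lo : ∀ {S} → S ⊆ Y → S ⊆ lo S
  S⊆lo {S} S⊆Y with m ≤? suc ∣ S ∣
  ... | yes _ = below-top S⊆Y id (⊆-min W) (λ x∈ → contradiction x∈ ∉⊥) ∘ ∪ˡ ∘ ∪ʳ
  ... | no _ = ∪ˡ ∘ ∪ʳ

  A∪S∪Z∩Y : ∀ {S Z} → Z ⊆ W → x ∈ (A ∪ S) ∪ Z → x ∈ Y → x ∈ S
  A∪S∪Z∩Y Z⊆W x∈ x∈Y with ∪⁻ x∈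
  ... | inj₂ x∈Z = contradiction x∈Y (proj₁ (W∩ (Z⊆W x∈Z)))
  ... | inj₁ x∈′ with ∪⁻ x∈′
  ...   | inj₁ x∈A = contradiction x∈Y (A∩Y x∈A)
  ...   | inj₂ x∈S = x∈S

  hi∩Y⊆ : ∀ {S x} → S ⊆ Y → x ∈ hi S → x ∈ Y → x ∈ S
  hi∩Y⊆ {S} {x} S⊆Y x∈hi x∈Y with m ≤? suc ∣ S ∣ | ∣ S ∣ <? 2
  ... | no _ | yes _ = A∪S∪Z∩Y (UT⊆W S) x∈hi x∈Y
  ... | no _ | no _ = A∪S∪Z∩Y (E⊆W (suc ∣ S ∣) ∘ x∈p─q⇒x∈p) x∈hi x∈Y
  ... | yes _ | _ with x ∈? S
  ...   | yes x∈S = x∈S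
  ...   | no x∉S = contradiction (∪ˡ (∪ʳ (x∈p∧x∉q⇒x∈p─q x∈Y x∉S))) (x∈∁p⇒x∉p x∈hi)

  ∣T∣+∣Y─T∣≡m : ∀ {T} → T ⊆ Y → ∣ T ∣ + ∣ Y ─ T ∣ ≡ m
  ∣T∣+∣Y─T∣≡m {T} T⊆Y = ≤-antisym
    (≤-trans (∣p∣+∣q∣≤∣p∪q∣ T (Y ─ T) λ x∈T x∈ → x∈p─q⇒x∉q Y T x∈ x∈T)
      (≤-trans (p⊆q⇒∣p∣≤∣q∣ (∪-least {q = Y ─ T} T⊆Y x∈p─q⇒x∈p)) (≤-reflexive ∣Y∣≡m)))
    (≤-trans (≤-reflexive (sym ∣Y∣≡m)) (∣q∣≤∣p∣+∣q─p∣ T Y))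

  -- On level 2 only two sets `U t` count. Higher up `E` contains all of `G₁`, which absorbs the
  -- sets `U t` however many there are.
  ∣bottom∣ : ∀ T j → ∣ T ∣ ≡ 2 + j → 3 + j < m → ∣ union T U ∪ E (2 + j) ∣ ≤ 2 * l + j * n
  ∣bottom∣ T zero ∣T∣≡ _ = begin
    ∣ union T U ∪ ⊥ ∣  ≤⟨ p⊆q⇒∣p∣≤∣q∣ (∪-least {p = union T U} id (⊆-min _)) ⟩
    ∣ union T U ∣      ≤⟨ ∣union∣≤ T U l ∣U∣≤ ⟩
    ∣ T ∣ * l          ≡⟨ cong (_* l) ∣T∣≡ ⟩
    2 * l              ≡⟨ +-identityʳ _ ⟨
    2 * l + 0          ∎
    where open ≤-Reasoning
  ∣bottom∣ T (suc j) ∣T∣≡ <m = ≤-trans (p⊆q⇒∣p∣≤∣q∣ (∪-least {p = union T U} (G₁⊆E j ∘ UT⊆G₁ T) id)) ∣E∣≤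
    where
    open ≤-Reasoning
    ∣E∣≤ : ∣ E (3 + j) ∣ ≤ 2 * l + (n + j * n)
    ∣E∣≤ with m ≤? 4 + j
    ... | yes m≤ = contradiction m≤ (<⇒≱ <m)
    ... | no _ = begin
      ∣ G₁ ∪ prefix (2 * l + j * n) H ∣      ≤⟨ ∣p∪q∣≤∣p∣+∣q∣ G₁ _ ⟩
      ∣ G₁ ∣ + ∣ prefix (2 * l + j * n) H ∣  ≤⟨ +-mono-≤ (≤-reflexive ∣G₁∣≡n) (∣prefix∣≤ (2 * l + j * n) H) ⟩
      n + (2 * l + j * n)                    ≡⟨ ((∀ n a b → n + (a + b) ≡ a + (n + b)) ∋ solve-∀) n (2 * l) (j * n) ⟩
      2 * l + (n + j * n)                    ∎

  -- On level `m ∸ 2` all of `W` is available and only two sets `V t` are removed. On lower levels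
  -- nothing is lost, because `E` is disjoint from `G₂`.
  ∣middle∣ : ∀ T j → T ⊆ Y → ∣ T ∣ ≡ 2 + j → 3 + j < m → 2 * l + suc j * n ≤ ∣ E (3 + j) ─ union (Y ─ T) V ∣
  ∣middle∣ T j T⊆Y ∣T∣≡ <m with m ≤? 4 + j
  ... | yes m≤ = +-cancelˡ-≤ (2 * u) _ _ (begin
      2 * u + (2 * l + suc j * n)                          ≡⟨ ((∀ l u a → 2 * u + (2 * l + a) ≡ a + 2 * (l + u)) ∋ solve-∀) l u (suc j * n) ⟩
      suc j * n + 2 * (l + u)                              ≡⟨ cong (λ i → (i ∸ 3) * n + 2 * (l + u)) (sym m≡) ⟩
      (m ∸ 3) * n + 2 * (l + u)                            ≤⟨ room ⟩
      ∣ W ∣                                                ≤⟨ ∣q∣≤∣p∣+∣q─p∣ (union (Y ─ T) V) W ⟩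
      ∣ union (Y ─ T) V ∣ + ∣ W ─ union (Y ─ T) V ∣        ≤⟨ +-monoˡ-≤ _ (∣union∣≤ (Y ─ T) V u ∣V∣≤) ⟩
      ∣ Y ─ T ∣ * u + ∣ W ─ union (Y ─ T) V ∣              ≡⟨ cong (λ i → i * u + ∣ W ─ union (Y ─ T) V ∣) ∣Y─T∣≡2 ⟩
      2 * u + ∣ W ─ union (Y ─ T) V ∣                      ∎)
    where
    open ≤-Reasoning
    m≡ : m ≡ 4 + j
    m≡ = ≤-antisym m≤ <m

    ∣Y─T∣≡2 : ∣ Y ─ T ∣ ≡ 2
    ∣Y─T∣≡2 = +-cancelˡ-≡ (2 + j) _ _ (trans (cong (_+ ∣ Y ─ T ∣) (sym ∣T∣≡)) (trans (∣T∣+∣Y─T∣≡m T⊆Y) (trans m≡ (cong (2 +_) (+-comm 2 j)))))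
  ... | no m≰ = begin
      2 * l + suc j * n                                    ≡⟨ ((∀ n a b → a + (n + b) ≡ n + (a + b)) ∋ solve-∀) n (2 * l) (j * n) ⟩
      n + h                                                ≡⟨ cong₂ _+_ (sym ∣G₁∣≡n) (sym (∣prefix∣ h H h≤∣H∣)) ⟩
      ∣ G₁ ∣ + ∣ prefix h H ∣                              ≤⟨ ∣p∣+∣q∣≤∣p∪q∣ G₁ (prefix h H) (λ x∈G₁ x∈ → proj₁ (H∩G (prefix⊆ h H x∈)) x∈G₁) ⟩
      ∣ G₁ ∪ prefix h H ∣                                  ≤⟨ p⊆q⇒∣p∣≤∣q∣ (λ x∈ → x∈p∧x∉q⇒x∈p─q x∈ (∉V x∈)) ⟩
      ∣ (G₁ ∪ prefix h H) ─ union (Y ─ T) V ∣              ∎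
    where
    open ≤-Reasoning
    h = 2 * l + j * n

    ∉V : x ∈ G₁ ∪ prefix h H → x ∉ union (Y ─ T) V
    ∉V x∈ x∈V = [ (λ x∈G₁ → G₁∩G₂ x∈G₁ x∈G₂) , (λ x∈ → proj₂ (H∩G (prefix⊆ h H x∈)) x∈G₂) ]′ (∪⁻ x∈)
      where x∈G₂ = VT⊆G₂ (Y ─ T) x∈V

    h≤∣H∣ : h ≤ ∣ H ∣
    -- Here `m` is at least `5 + j`, so `room` covers `G₁`, `G₂` and a further `j * n + 2 * l`
    -- elements.
    h≤∣H∣ = +-cancelˡ-≤ (n + n) _ _ (begin
      n + n + h                    ≡⟨ ((∀ n l j → n + n + (2 * l + j * n) ≡ (2 + j) * n + 2 * l) ∋ solve-∀) n l j ⟩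
      (2 + j) * n + 2 * l          ≤⟨ +-mono-≤ (*-monoˡ-≤ n (∸-monoˡ-≤ 3 (≰⇒> m≰))) (*-monoʳ-≤ 2 (m≤m+n l u)) ⟩
      (m ∸ 3) * n + 2 * (l + u)    ≤⟨ room ⟩
      ∣ W ∣                        ≤⟨ ∣q∣≤∣p∣+∣q─p∣ (G₁ ∪ G₂) W ⟩
      ∣ G₁ ∪ G₂ ∣ + ∣ H ∣          ≤⟨ +-monoˡ-≤ ∣ H ∣ (∣p∪q∣≤∣p∣+∣q∣ G₁ G₂) ⟩
      ∣ G₁ ∣ + ∣ G₂ ∣ + ∣ H ∣      ≡⟨ cong₂ (λ a b → a + b + ∣ H ∣) ∣G₁∣≡n ∣G₂∣≡n ⟩
      n + n + ∣ H ∣                ∎)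

  mid-width : ∀ T j → T ⊆ Y → ∣ T ∣ ≡ 2 + j → 3 + j < m → n ≤ ∣ middle T (2 + j) ─ bottom T (2 + j) ∣
  mid-width T j T⊆Y ∣T∣≡ <m = ≤-trans width (p⊆q⇒∣p∣≤∣q∣ new)
    where
    P = union T U ∪ E (2 + j)
    P′ = E (3 + j) ─ union (Y ─ T) V

    width : n ≤ ∣ P′ ─ P ∣
    width = +-cancelˡ-≤ (2 * l + j * n) _ _ (begin
      2 * l + j * n + n               ≡⟨ ((∀ n a b → a + b + n ≡ a + (n + b)) ∋ solve-∀) n (2 * l) (j * n) ⟩
      2 * l + suc j * n               ≤⟨ ∣middle∣ T j T⊆Y ∣T∣≡ <m ⟩
      ∣ P′ ∣                          ≤⟨ ∣q∣≤∣p∣+∣q─p∣ P P′ ⟩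
      ∣ P ∣ + ∣ P′ ─ P ∣              ≤⟨ +-monoˡ-≤ _ (∣bottom∣ T j ∣T∣≡ <m) ⟩
      2 * l + j * n + ∣ P′ ─ P ∣      ∎)
      where open ≤-Reasoning

    new : P′ ─ P ⊆ middle T (2 + j) ─ bottom T (2 + j)
    new x∈ = x∈p∧x∉q⇒x∈p─q (∪ʳ x∈P′) ([ [ proj₁ (proj₂ out) , proj₁ out ∘ T⊆Y ]′ ∘ ∪⁻ , x∈p─q⇒x∉q P′ P x∈ ]′ ∘ ∪⁻)
      where
      x∈P′ = x∈p─q⇒x∈p {p = P′} x∈
      out = W∩ (E⊆W (3 + j) (x∈p─q⇒x∈p x∈P′))

  bottom⊆middle : ∀ T j → T ⊆ Y → 3 + j < m → bottom T (2 + j) ⊆ middle T (2 + j)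
  bottom⊆middle T j T⊆Y <m = ∪-mono id (∪-least
    (λ x∈ → x∈p∧x∉q⇒x∈p─q (G₁⊆E j (UT⊆G₁ T x∈)) (UT∩V T (Y ─ T) x∈))
    (λ x∈ → x∈p∧x∉q⇒x∈p─q (E-mono (n≤1+n (2 + j)) x∈) (E∩G₂ <m x∈ ∘ VT⊆G₂ (Y ─ T))))

  E-small : ∀ {i} → i < 2 → E i ⊆ p
  E-small {i = 0} _ = ⊆-min _
  E-small {i = 1} _ = ⊆-min _
  E-small {i = suc (suc _)} (s≤s (s≤s ()))

  choice : ∀ T → T ⊆ Y → Between c Red (lo T) (hi T) ⊎ Copy c Blue n
  choice T T⊆Y with m ≤? suc ∣ T ∣ | ∣ T ∣ <? 2
  ... | yes m≤ | _ = inj₁ (exactly (top T) (cofan-red {Y ─ T} x∈p─q⇒x∈p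
      (+-cancelˡ-≤ ∣ T ∣ _ _ (≤-trans (≤-reflexive (∣T∣+∣Y─T∣≡m T⊆Y)) (≤-trans m≤ (≤-reflexive (+-comm 1 ∣ T ∣)))))))
  ... | no _ | yes T<2 = inj₁ (low T , ∪-mono id (∪-least id (E-small T<2)) , id , low-red T⊆Y (s≤s⁻¹ T<2))
  ... | no m≰ | no T≮2 = mid (∣ T ∣ ∸ 2) (sym (m+[n∸m]≡n (≮⇒≥ T≮2))) (≰⇒> m≰)
    where
    mid : ∀ j → ∣ T ∣ ≡ 2 + j → suc ∣ T ∣ < m → Between c Red (bottom T ∣ T ∣) (middle T ∣ T ∣) ⊎ Copy c Blue n
    mid j ∣T∣≡ <m = subst (λ i → Between c Red (bottom T i) (middle T i) ⊎ Copy c Blue n) (sym ∣T∣≡)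
      (window c Red (bottom T (2 + j)) (middle T (2 + j)) (bottom⊆middle T j T⊆Y <m′) (mid-width T j T⊆Y ∣T∣≡ <m′))
      where <m′ = subst (λ i → suc i < m) ∣T∣≡ <m

  copy : Copy c Red m ⊎ Copy c Blue n
  copy = interval-copy c Red Y ∣Y∣≡m lo hi choice step S⊆lo hi∩Y⊆

-- Transitions from flat to red.

∀-or : {P : Fin k → Set} {R : Set} → (∀ t → P t ⊎ R) → (∀ t → P t) ⊎ R
∀-or {zero} h = inj₁ λ ()
∀-or {suc k} h with h zero | ∀-or (h ∘ suc)
... | inj₂ r | _ = inj₂ r
... | inj₁ _ | inj₂ r = inj₂ r
... | inj₁ P0 | inj₁ Ps = inj₁ λ { zero → P0 ; (suc t) → Ps t }

-- `suc l` is the first positive argument at which `h` answers `R`; up to `l` the property `P` has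
-- persisted.
crossing : {P R : ℕ → Set} → P 0 → (∀ l → P l ⊎ R l) → ∀ b → P b ⊎ ∃ λ l → l < b × P l × R (suc l)
crossing P0 h zero = inj₁ P0
crossing P0 h (suc b) with crossing P0 h b
... | inj₂ (l , l<b , Pl , Rl) = inj₂ (l , m≤n⇒m≤1+n l<b , Pl , Rl)
... | inj₁ Pb with h (suc b)
...   | inj₁ Psb = inj₁ Psb
...   | inj₂ Rsb = inj₂ (b , ≤-refl , Pb , Rsb)

flat-⊆ : ∀ {c : Coloring N} {B G G′ l} → G′ ⊆ G → Flat c B G l → Flat c B G′ l
flat-⊆ G′⊆G flat S S⊆G′ = flat S (G′⊆G ∘ S⊆G′)

flat-0 : ∀ {c : Coloring N} {B G} → Flat c B G 0
flat-0 S _ ()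

-- Red sets near the bottom and the top.

module Ramsey {N m n y : ℕ} (c : Coloring N) (y<n : y < n)
  (N≡ : N ≡ m + 1 + ((m ∸ 3) * n + 3 * y))
  (blob-room : n + (2 + y) + m * (n ∸ y) ≤ N) (2n≤ : 2 * n ≤ (m ∸ 3) * n + 2 * y) where

  Monochromatic : Set
  Monochromatic = Copy c Red m ⊎ Copy c Blue n

  -- With `l + u` equal to `y + 1` there remain `n ∸ y` levels at `m` elements each; `X` takes `n`
  -- elements, and `B` and `D` at most `2 + y`. This sum is what `blob-room` bounds.
  flat-ends : ∀ (B D X : Subset N) l u → ∣ X ∣ ≡ n → Disjoint B X → Disjoint D X → Disjoint B D →
    ∣ B ∣ + ∣ D ∣ ≤ 2 + y → Flat c B X l → Flat (c ∘ ∁) D X u → l + u ≡ suc y → Monochromatic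
  flat-ends B D X l u ∣X∣≡n B∩X D∩X B∩D ∣B∣+∣D∣≤ low high l+u≡ = Sum.swap
    (FlatEnds.copy c B D X l u ∣X∣≡n B∩X D∩X B∩D low high (≤-trans (≤-reflexive l+u≡) y<n)
      (+-cancelˡ-≤ (n + (2 + y)) _ _ (begin
        n + (2 + y) + m * (n + 1 ∸ (l + u))      ≡⟨ cong (λ i → n + (2 + y) + m * i) (cong₂ _∸_ (+-comm n 1) l+u≡) ⟩
        n + (2 + y) + m * (n ∸ y)                ≤⟨ blob-room ⟩
        N                                        ≡⟨ sym (∣p∣+∣∁p∣≡n (X ∪ B ∪ D)) ⟩
        ∣ X ∪ B ∪ D ∣ + ∣ ∁ (X ∪ B ∪ D) ∣        ≤⟨ +-monoˡ-≤ _ (≤-trans (∣p∪q∣≤∣p∣+∣q∣ X (B ∪ D)) (+-mono-≤ (≤-reflexive ∣X∣≡n) (≤-trans (∣p∪q∣≤∣p∣+∣q∣ B D) ∣B∣+∣D∣≤))) ⟩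
        n + (2 + y) + ∣ ∁ (X ∪ B ∪ D) ∣          ∎)))
    where open ≤-Reasoning

  -- One element more than needed: no sets Vₜ are available for the t = e realising the bound l.
  P W : Subset N
  P = prefix (m + 1) ⊤
  W = ∁ P

  ∣P∣≡ : ∣ P ∣ ≡ m + 1
  ∣P∣≡ = ∣prefix∣ (m + 1) ⊤ (≤-trans (m≤m+n (m + 1) _) (≤-reflexive (trans (sym N≡) (sym (∣⊤∣≡n N)))))

  ∣W∣≡ : ∣ W ∣ ≡ (m ∸ 3) * n + 3 * y
  ∣W∣≡ = +-cancelˡ-≡ (m + 1) _ _ (trans (cong (_+ ∣ W ∣) (sym ∣P∣≡)) (trans (∣p∣+∣∁p∣≡n P) N≡))

  ∣⊥∣+∣⊥∣≤ : ∣ ⊥ {N} ∣ + ∣ ⊥ {N} ∣ ≤ 2 + y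
  ∣⊥∣+∣⊥∣≤ = ≤-trans (≤-reflexive (cong₂ _+_ (∣⊥∣≡0 N) (∣⊥∣≡0 N))) z≤n

  ⊥-disjoint : ∀ {p : Subset N} → Disjoint ⊥ p
  ⊥-disjoint x∈ _ = ∉⊥ x∈

  -- Taking `C` in `W ─ A` also records that it is disjoint from `A`.
  record Ends : Set where
    field
      A C : Subset N
      A⊆W : A ⊆ W
      C⊆W─A : C ⊆ W ─ A
      size : ∣ A ∣ + ∣ C ∣ ≤ y
      A-red : c A ≡ Red
      C-red : c (∁ C) ≡ Red

  room-in-W : ∀ A → ∣ A ∣ ≤ y → n ≤ ∣ W ─ A ∣
  room-in-W A ∣A∣≤ = +-cancelˡ-≤ y _ _ (begin
    y + n                                ≤⟨ +-mono-≤ (m≤m+n y 0) (m≤m+n n (n + 0)) ⟩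
    (y + 0) + 2 * n                      ≤⟨ +-monoʳ-≤ (y + 0) 2n≤ ⟩
    (y + 0) + ((m ∸ 3) * n + 2 * y)      ≡⟨ ((∀ a y → (y + 0) + (a + 2 * y) ≡ a + 3 * y) ∋ solve-∀) ((m ∸ 3) * n) y ⟩
    (m ∸ 3) * n + 3 * y                  ≡⟨ sym ∣W∣≡ ⟩
    ∣ W ∣                                ≤⟨ ∣q∣≤∣p∣+∣q─p∣ A W ⟩
    ∣ A ∣ + ∣ W ─ A ∣                    ≤⟨ +-monoˡ-≤ _ ∣A∣≤ ⟩
    y + ∣ W ─ A ∣                        ∎)
    where open ≤-Reasoning

  ends : Ends ⊎ Monochromatic
  ends with crossing {R = RedWithin c ⊥ W} (flat-0 {c = c}) (flat-or-red c ⊥ W) (suc y)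
  -- The lower end alone supplies all `y + 1` flat levels, so `u` is 0.
  ... | inj₁ flat = inj₂ (flat-ends ⊥ ⊥ (prefix n (W ─ ⊥)) (suc y) 0 (∣prefix∣ n (W ─ ⊥) (room-in-W ⊥ (≤-trans (≤-reflexive (∣⊥∣≡0 N)) z≤n)))
          ⊥-disjoint ⊥-disjoint ⊥-disjoint ∣⊥∣+∣⊥∣≤
          (flat-⊆ {c = c} (x∈p─q⇒x∈p ∘ prefix⊆ n (W ─ ⊥)) flat) (flat-0 {c = c ∘ ∁}) (+-identityʳ _))
  -- The lower end is flat below `a` but has a red set of size at most `a`. A flat upper end with
  -- `suc y ∸ a` levels would complete `y + 1`; otherwise `C` has at most `y ∸ a` elements.
  ... | inj₂ (a , s≤s a≤y , flat , A , A⊆W , s≤s ∣A∣≤a , A-red) with flat-or-red (c ∘ ∁) ⊥ (W ─ A) (suc y ∸ a)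
  ...   | inj₁ high = inj₂ (flat-ends ⊥ ⊥ (prefix n (W ─ A)) a (suc y ∸ a) (∣prefix∣ n (W ─ A) (room-in-W A (≤-trans ∣A∣≤a a≤y)))
          ⊥-disjoint ⊥-disjoint ⊥-disjoint ∣⊥∣+∣⊥∣≤
          (flat-⊆ {c = c} (x∈p─q⇒x∈p ∘ prefix⊆ n (W ─ A)) flat) (flat-⊆ {c = c ∘ ∁} (prefix⊆ n (W ─ A)) high)
          (m+[n∸m]≡n (m≤n⇒m≤1+n a≤y)))
  ...   | inj₂ (C , C⊆ , ∣C∣< , C-red) = inj₁ record
          { A = A ; C = C ; A⊆W = A⊆W ; C⊆W─A = C⊆
          ; size = ≤-trans (+-mono-≤ ∣A∣≤a (s≤s⁻¹ (≤-trans ∣C∣< (≤-reflexive (+-∸-assoc 1 a≤y))))) (≤-reflexive (m+[n∸m]≡n a≤y))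
          ; A-red = trans (cong c (sym (∪-identityˡ A))) A-red
          ; C-red = trans (cong (c ∘ ∁) (sym (∪-identityˡ C))) C-red }

  -- Bounds for the fans at both ends.

  module WithEnds (E : Ends) where
    open Ends E

    Free : Subset N
    Free = ∁ (P ∪ A ∪ C)

    Free∩ : x ∈ Free → x ∉ P × x ∉ A × x ∉ C
    Free∩ x∈V = x∉ ∘ ∪ˡ , x∉ ∘ ∪ʳ ∘ ∪ˡ , x∉ ∘ ∪ʳ ∘ ∪ʳ
      where x∉ = x∈∁p⇒x∉p x∈V

    A∩P : Disjoint A P
    A∩P x∈A = x∈∁p⇒x∉p (A⊆W x∈A)

    C∩P : Disjoint C P
    C∩P x∈C = x∈∁p⇒x∉p (x∈p─q⇒x∈p {p = W} (C⊆W─A x∈C))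

    A∩C : Disjoint A C
    A∩C x∈A x∈C = x∈p─q⇒x∉q W A (C⊆W─A x∈C) x∈A

    ∣Free∣≥ : (m ∸ 3) * n + 2 * y ≤ ∣ Free ∣
    ∣Free∣≥ = +-cancelˡ-≤ (m + 1 + y) _ _ (begin
      m + 1 + y + ((m ∸ 3) * n + 2 * y)    ≡⟨ ((∀ p a y → p + y + (a + 2 * y) ≡ p + (a + 3 * y)) ∋ solve-∀) (m + 1) ((m ∸ 3) * n) y ⟩
      m + 1 + ((m ∸ 3) * n + 3 * y)        ≡⟨ sym N≡ ⟩
      N                                    ≡⟨ sym (∣p∣+∣∁p∣≡n (P ∪ A ∪ C)) ⟩
      ∣ P ∪ A ∪ C ∣ + ∣ Free ∣                ≤⟨ +-monoˡ-≤ ∣ Free ∣ (≤-trans (∣p∪q∣≤∣p∣+∣q∣ P (A ∪ C)) (+-mono-≤ (≤-reflexive ∣P∣≡) (≤-trans (∣p∪q∣≤∣p∣+∣q∣ A C) size))) ⟩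
      m + 1 + y + ∣ Free ∣                    ∎)
      where open ≤-Reasoning

    -- `e` is the element at which the lower end was flat below `l`. It is exempt from `above`:
    -- `A ∪ ⁅ e ⁆` and `C ∪ ⁅ e ⁆` are not disjoint, so no blue lattice can be built between these
    -- two ends.
    record Level (G : Subset N) : Set where
      field
        l     : ℕ
        e     : Fin N
        below : ∀ {t} → t ∈ P → RedWithin c (A ∪ ⁅ t ⁆) G (suc l)
        above : ∀ {t} → t ∈ P → t ≢ e → RedWithin (c ∘ ∁) (C ∪ ⁅ t ⁆) G (suc (y ∸ l))
        l≤y   : l ≤ y

    P-nonempty : Nonempty P
    P-nonempty with nonempty? P
    ... | yes ne = ne
    ... | no ¬ne = contradiction (trans (+-comm 1 m) (trans (sym ∣P∣≡) (trans (cong ∣_∣ (Empty-unique ¬ne)) (∣⊥∣≡0 N)))) 1+n≢0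

    ∪⁅⁆-disjoint : ∀ {B G t} → G ⊆ Free → t ∈ P → Disjoint B Free → Disjoint (B ∪ ⁅ t ⁆) G
    ∪⁅⁆-disjoint {t = t} G⊆V t∈P B∩V x∈ x∈G with ∪⁻ x∈
    ... | inj₁ x∈B = B∩V x∈B (G⊆V x∈G)
    ... | inj₂ x∈t rewrite x∈⁅y⁆⇒x≡y t x∈t = proj₁ (Free∩ (G⊆V x∈G)) t∈P

    A∩V : Disjoint A Free
    A∩V x∈A x∈V = proj₁ (proj₂ (Free∩ x∈V)) x∈A

    C∩V : Disjoint C Free
    C∩V x∈C x∈V = proj₂ (proj₂ (Free∩ x∈V)) x∈C

    -- `l` is found by `crossing`: some `e` is still flat below `l`, while every `t` has a red set
    -- within `suc l`. Flatness at `e` then forces red sets within `suc (y ∸ l)` at the upper end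
    -- for all other `t`.
    level : ∀ G → G ⊆ Free → ∣ G ∣ ≡ n → Level G ⊎ Monochromatic
    level G G⊆V ∣G∣≡n = [ inj₂ ∘ full , partial ]′ (crossing start or (suc y))
      where
      SomeFlat AllRed : ℕ → Set
      SomeFlat l = ∃ λ t → t ∈ P × Flat c (A ∪ ⁅ t ⁆) G l
      AllRed l = ∀ t → t ∈ P → RedWithin c (A ∪ ⁅ t ⁆) G l

      start : SomeFlat 0
      start = proj₁ P-nonempty , proj₂ P-nonempty , flat-0 {c = c}

      or : ∀ l → SomeFlat l ⊎ AllRed l
      or l = Sum.swap (∀-or one)
        where
        one : ∀ t → (t ∈ P → RedWithin c (A ∪ ⁅ t ⁆) G l) ⊎ SomeFlat l
        one t with t ∈? P | flat-or-red c (A ∪ ⁅ t ⁆) G l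
        ... | no t∉P | _ = inj₁ λ t∈P → contradiction t∈P t∉P
        ... | yes _ | inj₂ red = inj₁ λ _ → red
        ... | yes t∈P | inj₁ flat = inj₂ (t , t∈P , flat)

      ∣∪⁅⁆∣≤ : ∀ B t → ∣ B ∪ ⁅ t ⁆ ∣ ≤ ∣ B ∣ + 1
      ∣∪⁅⁆∣≤ B t = ≤-trans (∣p∪q∣≤∣p∣+∣q∣ B ⁅ t ⁆) (+-monoʳ-≤ ∣ B ∣ (≤-reflexive (∣⁅x⁆∣≡1 t)))

      sizes : ∀ s t → ∣ A ∪ ⁅ s ⁆ ∣ + ∣ C ∪ ⁅ t ⁆ ∣ ≤ 2 + y
      sizes s t = begin
        ∣ A ∪ ⁅ s ⁆ ∣ + ∣ C ∪ ⁅ t ⁆ ∣    ≤⟨ +-mono-≤ (∣∪⁅⁆∣≤ A s) (∣∪⁅⁆∣≤ C t) ⟩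
        (∣ A ∣ + 1) + (∣ C ∣ + 1)        ≡⟨ ((∀ a b → (a + 1) + (b + 1) ≡ 2 + (a + b)) ∋ solve-∀) ∣ A ∣ ∣ C ∣ ⟩
        2 + (∣ A ∣ + ∣ C ∣)              ≤⟨ +-monoʳ-≤ 2 size ⟩
        2 + y                            ∎
        where open ≤-Reasoning

      full : SomeFlat (suc y) → Monochromatic
      full (e , e∈P , flat) = flat-ends (A ∪ ⁅ e ⁆) ⊥ G (suc y) 0 ∣G∣≡n (∪⁅⁆-disjoint {A} G⊆V e∈P A∩V) ⊥-disjoint (λ _ → ∉⊥)
        (≤-trans (+-monoʳ-≤ _ (≤-trans (≤-reflexive (∣⊥∣≡0 N)) z≤n)) (sizes e e)) flat (flat-0 {c = c ∘ ∁}) (+-identityʳ _)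

      partial : (∃ λ l → l < suc y × SomeFlat l × AllRed (suc l)) → Level G ⊎ Monochromatic
      partial (l , s≤s l≤y , (e , e∈P , flat) , red) = map₁ (λ above → record
        { l = l ; e = e ; below = λ {t} → red t ; above = λ {t} → above t ; l≤y = l≤y }) (∀-or one)
        where
        one : ∀ t → (t ∈ P → t ≢ e → RedWithin (c ∘ ∁) (C ∪ ⁅ t ⁆) G (suc (y ∸ l))) ⊎ Monochromatic
        one t with t ∈? P | t ≟ e | flat-or-red (c ∘ ∁) (C ∪ ⁅ t ⁆) G (suc (y ∸ l))
        ... | no t∉P | _ | _ = inj₁ λ t∈P → contradiction t∈P t∉P
        ... | yes _ | yes t≡e | _ = inj₁ λ _ t≢e → contradiction t≡e t≢e
        ... | yes _ | no _ | inj₂ red = inj₁ λ _ _ → red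
        -- The `l` flat levels at `e` and the `suc (y ∸ l)` flat levels at `t` add up to `y + 1`.
        ... | yes t∈P | no t≢e | inj₁ high = inj₂ (flat-ends (A ∪ ⁅ e ⁆) (C ∪ ⁅ t ⁆) G l (suc (y ∸ l)) ∣G∣≡n
            (∪⁅⁆-disjoint {A} G⊆V e∈P A∩V) (∪⁅⁆-disjoint {C} G⊆V t∈P C∩V) disjoint (sizes e t) flat high
            (trans (+-suc l (y ∸ l)) (cong suc (m+[n∸m]≡n l≤y))))
          where
          disjoint : Disjoint (A ∪ ⁅ e ⁆) (C ∪ ⁅ t ⁆)
          disjoint x∈ x∈′ with ∪⁻ x∈ | ∪⁻ x∈′
          ... | inj₁ x∈A | inj₁ x∈C = A∩C x∈A x∈C
          ... | inj₁ x∈A | inj₂ x∈t rewrite x∈⁅y⁆⇒x≡y t x∈t = A∩P x∈A t∈P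
          ... | inj₂ x∈e | inj₁ x∈C rewrite x∈⁅y⁆⇒x≡y e x∈e = C∩P x∈C e∈P
          ... | inj₂ x∈e | inj₂ x∈t = t≢e (trans (sym (x∈⁅y⁆⇒x≡y t x∈t)) (x∈⁅y⁆⇒x≡y e x∈e))

    -- The lower fan lives in `G` and the upper one in `H`, which keeps them disjoint; the
    -- comparison of levels bounds the sum of their two bounds by `y`.
    fans : ∀ {G H} → G ⊆ Free → H ⊆ Free → Disjoint G H → ∣ G ∣ ≡ n → ∣ H ∣ ≡ n →
      (g : Level G) (h : Level H) → Level.l g ≤ Level.l h → Monochromatic
    fans {G} {H} G⊆V H⊆V G∩H ∣G∣≡n ∣H∣≡n g h lg≤lh =
      TwoFans.copy c A C Y G H (Level.l g) (y ∸ Level.l h) ∣Y∣≡m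
        (λ x∈A x∈Y → A∩P x∈A (Y⊆P x∈Y)) (λ x∈C x∈Y → C∩P x∈C (Y⊆P x∈Y)) A∩C
        (Free⊆ ∘ G⊆V) (Free⊆ ∘ H⊆V) G∩H ∣G∣≡n ∣H∣≡n
        (red-within⇒fan c A Y G _ A-red (Level.below g ∘ Y⊆P))
        (red-within⇒fan (c ∘ ∁) C Y H _ C-red λ t∈Y → Level.above h (Y⊆P t∈Y) (t≢e t∈Y))
        (≤-trans (+-monoʳ-≤ ((m ∸ 3) * n) (*-monoʳ-≤ 2 (≤-trans (+-monoˡ-≤ (y ∸ Level.l h) lg≤lh) (≤-reflexive (m+[n∸m]≡n (Level.l≤y h))))))
          (≤-trans ∣Free∣≥ (p⊆q⇒∣p∣≤∣q∣ Free⊆)))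
      where
      P′ Y : Subset N
      -- Only the upper fan has an exceptional element, that of `h`; removing it from the `m + 1`
      -- elements of `P` leaves `m`.
      P′ = P ─ ⁅ Level.e h ⁆
      Y = prefix m P′

      Y⊆P : Y ⊆ P
      Y⊆P x∈Y = x∈p─q⇒x∈p (prefix⊆ m P′ x∈Y)

      t≢e : ∀ {t} → t ∈ Y → t ≢ Level.e h
      t≢e t∈Y refl = x∈p─q⇒x∉q P ⁅ Level.e h ⁆ (prefix⊆ m P′ t∈Y) (x∈⁅x⁆ (Level.e h))

      Free⊆ : Free ⊆ ∁ (Y ∪ A ∪ C)
      Free⊆ = p⊆q⇒∁p⊇∁q (∪-mono Y⊆P id)

      ∣Y∣≡m : ∣ Y ∣ ≡ m
      ∣Y∣≡m = ∣prefix∣ m P′ (+-cancelˡ-≤ 1 _ _ (begin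
        1 + m                            ≤⟨ ≤-reflexive (trans (+-comm 1 m) (sym ∣P∣≡)) ⟩
        ∣ P ∣                            ≤⟨ ∣q∣≤∣p∣+∣q─p∣ ⁅ Level.e h ⁆ P ⟩
        ∣ ⁅ Level.e h ⁆ ∣ + ∣ P′ ∣       ≡⟨ cong (_+ ∣ P′ ∣) (∣⁅x⁆∣≡1 (Level.e h)) ⟩
        1 + ∣ P′ ∣                       ∎))
        where open ≤-Reasoning

    G₁ G₂ : Subset N
    G₁ = prefix n Free
    G₂ = prefix n (Free ─ G₁)

    2n≤∣Free∣ : n + n ≤ ∣ Free ∣
    2n≤∣Free∣ = ≤-trans (≤-reflexive (cong (n +_) (sym (+-identityʳ n)))) (≤-trans 2n≤ ∣Free∣≥)

    ∣G₁∣≡n : ∣ G₁ ∣ ≡ n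
    ∣G₁∣≡n = ∣prefix∣ n Free (≤-trans (m≤m+n n n) 2n≤∣Free∣)

    ∣G₂∣≡n : ∣ G₂ ∣ ≡ n
    ∣G₂∣≡n = ∣prefix∣ n (Free ─ G₁) (+-cancelˡ-≤ n _ _ (≤-trans 2n≤∣Free∣ (≤-trans (∣q∣≤∣p∣+∣q─p∣ G₁ Free) (+-monoˡ-≤ _ (≤-reflexive ∣G₁∣≡n)))))

    G₂⊆V─G₁ : G₂ ⊆ Free ─ G₁
    G₂⊆V─G₁ = prefix⊆ n (Free ─ G₁)

    G₁⊆V : G₁ ⊆ Free
    G₁⊆V = prefix⊆ n Free

    G₂⊆V : G₂ ⊆ Free
    G₂⊆V = x∈p─q⇒x∈p ∘ G₂⊆V─G₁

    monochromatic : Monochromatic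
    monochromatic with level G₁ G₁⊆V ∣G₁∣≡n | level G₂ G₂⊆V ∣G₂∣≡n
    ... | inj₂ done | _ = done
    ... | inj₁ _ | inj₂ done = done
    -- The lower fan is taken from the side with the smaller bound `l`.
    ... | inj₁ g | inj₁ h with ≤-total (Level.l g) (Level.l h)
    ...   | inj₁ lg≤lh = fans G₁⊆V G₂⊆V (λ x∈G₁ x∈G₂ → x∈p─q⇒x∉q Free G₁ (G₂⊆V─G₁ x∈G₂) x∈G₁) ∣G₁∣≡n ∣G₂∣≡n g h lg≤lh
    ...   | inj₂ lh≤lg = fans G₂⊆V G₁⊆V (λ x∈G₂ x∈G₁ → x∈p─q⇒x∉q Free G₁ (G₂⊆V─G₁ x∈G₂) x∈G₁) ∣G₂∣≡n ∣G₁∣≡n h g lh≤lg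

  monochromatic : Monochromatic
  monochromatic = [ WithEnds.monochromatic , id ]′ ends

-- Choice of `y` and the numerical bound.

module Arithmetic (k n : ℕ) (4≤n : 4 ≤ n) where
  m y : ℕ
  m = 4 + k
  -- For `y ≤ n`, `blob-room` reduces to `4 * n + 3 ≤ (m + 2) * suc y`; this is the least such `y`,
  -- with `6 + k` for `m + 2`.
  y = (4 * n + 2) / (6 + k)

  y-upper : (6 + k) * y ≤ 4 * n + 2
  y-upper = ≤-trans (≤-reflexive (*-comm (6 + k) y)) (m/n*n≤m (4 * n + 2) (6 + k))

  y-lower : 4 * n + 3 ≤ (6 + k) * suc y
  y-lower = begin
    4 * n + 3                               ≡⟨ +-suc (4 * n) 2 ⟩
    suc (4 * n + 2)                         ≡⟨ cong suc (m≡m%n+[m/n]*n (4 * n + 2) (6 + k)) ⟩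
    suc ((4 * n + 2) % (6 + k)) + y * (6 + k)  ≤⟨ +-monoˡ-≤ _ (m%n<n (4 * n + 2) (6 + k)) ⟩
    suc y * (6 + k)                         ≡⟨ *-comm (suc y) (6 + k) ⟩
    (6 + k) * suc y                         ∎
    where open ≤-Reasoning

  y<n : y < n
  y<n = ≰⇒> λ n≤y → <⇒≱ (+-monoʳ-< (4 * n) (≤-trans (m≤m+n 3 1) (≤-trans 4≤n (m≤m+n n (n + 0))))) (begin
    4 * n + 2 * n          ≡⟨ ((∀ n → 4 * n + 2 * n ≡ 6 * n) ∋ solve-∀) n ⟩
    6 * n                  ≤⟨ *-mono-≤ (m≤m+n 6 k) n≤y ⟩
    (6 + k) * y            ≤⟨ y-upper ⟩
    4 * n + 2              ∎)
    where open ≤-Reasoning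

  blob-room : n + (2 + y) + m * (n ∸ y) ≤ m + 1 + ((m ∸ 3) * n + 3 * y)
  blob-room = +-cancelʳ-≤ (m * y) _ _ (begin
    n + (2 + y) + m * (n ∸ y) + m * y             ≡⟨ +-assoc (n + (2 + y)) (m * (n ∸ y)) (m * y) ⟩
    n + (2 + y) + (m * (n ∸ y) + m * y)           ≡⟨ cong (n + (2 + y) +_) (sym (*-distribˡ-+ m (n ∸ y) y)) ⟩
    n + (2 + y) + m * (n ∸ y + y)                 ≡⟨ cong (λ i → n + (2 + y) + m * i) (m∸n+n≡m (<⇒≤ y<n)) ⟩
    n + (2 + y) + m * n                           ≡⟨ ((∀ n y k → n + (2 + y) + (4 + k) * n ≡ (1 + k) * n + y + 2 + 4 * n) ∋ solve-∀) n y k ⟩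
    (1 + k) * n + y + 2 + 4 * n                   ≤⟨ +-cancelʳ-≤ 3 _ _ (≤-trans (≤-reflexive (+-assoc ((1 + k) * n + y + 2) (4 * n) 3)) (≤-trans (+-monoʳ-≤ ((1 + k) * n + y + 2) y-lower)
                                                      (≤-reflexive (((∀ n y k → (1 + k) * n + y + 2 + (6 + k) * suc y ≡ 4 + k + 1 + ((1 + k) * n + 3 * y) + (4 + k) * y + 3) ∋ solve-∀) n y k)))) ⟩
    m + 1 + ((1 + k) * n + 3 * y) + m * y         ∎)
    where open ≤-Reasoning

  2n≤ : 2 * n ≤ (m ∸ 3) * n + 2 * y
  2n≤ with m≤n⇒m<n∨m≡n (z≤n {k})
  ... | inj₁ 0<k = ≤-trans (*-monoˡ-≤ n (s≤s 0<k)) (m≤m+n _ (2 * y))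
  -- For `m = 4` the first summand is only `n`, so `n ≤ 2 * y` is needed; `2 * y < n` would turn
  -- `y-lower` into `4 * n + 3 ≤ 3 * n + 3`.
  ... | inj₂ refl = ≤-trans (≤-reflexive (cong (n +_) (+-identityʳ n))) (+-mono-≤ (m≤m+n n 0) (≮⇒≥ λ 2y<n →
      <⇒≱ (+-monoʳ-< (3 * n) (≤-trans 4≤n (m≤m+n n 3))) (begin
        3 * n + (n + 3)       ≡⟨ ((∀ n → 3 * n + (n + 3) ≡ 4 * n + 3) ∋ solve-∀) n ⟩
        4 * n + 3             ≤⟨ y-lower ⟩
        6 * suc y             ≡⟨ ((∀ y → 6 * suc y ≡ 3 * suc (2 * y) + 3) ∋ solve-∀) y ⟩
        3 * suc (2 * y) + 3   ≤⟨ +-monoˡ-≤ 3 (*-monoʳ-≤ 3 2y<n) ⟩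
        3 * n + 3             ∎)))
    where open ≤-Reasoning

  M d : ℕ
  M = m + 1 + ((m ∸ 3) * n + 3 * y)
  d = (5 + 2 * k) * (5 + k)

  -- By `y-upper`, `3 * y` is at most `(12 * n + 6) / (m + 2)`. It remains to compare `12 / (m + 2)`
  -- with `1 + (9 * m ∸ 9) / d`, and `6 / (m + 2)` with 2.
  3yd≤ : 3 * y * d ≤ (d + 9 * (3 + k)) * n + 2 * d
  3yd≤ = *-cancelˡ-≤ (6 + k) (begin
    (6 + k) * (3 * y * d)                          ≡⟨ ((∀ k y d → (6 + k) * (3 * y * d) ≡ (6 + k) * y * (3 * d)) ∋ solve-∀) k y d ⟩
    (6 + k) * y * (3 * d)                          ≤⟨ *-monoˡ-≤ (3 * d) y-upper ⟩
    -- The added polynomial is the exact difference of the two sides; its coefficients are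
    -- nonnegative because of the substitution `m = 4 + k`.
    (4 * n + 2) * (3 * d)                          ≤⟨ m≤m+n _ ((12 + 16 * k + 12 * k * k + 2 * k * k * k) * n + (6 + 2 * k) * d) ⟩
    (4 * n + 2) * (3 * d) + ((12 + 16 * k + 12 * k * k + 2 * k * k * k) * n + (6 + 2 * k) * d)
      ≡⟨ ((∀ k n → (4 * n + 2) * (3 * ((5 + 2 * k) * (5 + k))) + ((12 + 16 * k + 12 * k * k + 2 * k * k * k) * n + (6 + 2 * k) * ((5 + 2 * k) * (5 + k)))
            ≡ (6 + k) * (((5 + 2 * k) * (5 + k) + 9 * (3 + k)) * n + 2 * ((5 + 2 * k) * (5 + k)))) ∋ solve-∀) k n ⟩
    (6 + k) * ((d + 9 * (3 + k)) * n + 2 * d)      ∎)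
    where open ≤-Reasoning

  Md≤ : M * d ≤ ((2 + k) * d + 9 * (3 + k)) * n + (7 + k) * d
  Md≤ = begin
    M * d                                                              ≡⟨ ((∀ k n y d → (4 + k + 1 + ((1 + k) * n + 3 * y)) * d ≡ (5 + k + (1 + k) * n) * d + 3 * y * d) ∋ solve-∀) k n y d ⟩
    (5 + k + (1 + k) * n) * d + 3 * y * d                              ≤⟨ +-monoʳ-≤ ((5 + k + (1 + k) * n) * d) 3yd≤ ⟩
    (5 + k + (1 + k) * n) * d + ((d + 9 * (3 + k)) * n + 2 * d)        ≡⟨ ((∀ k n d → (5 + k + (1 + k) * n) * d + ((d + 9 * (3 + k)) * n + 2 * d) ≡ ((2 + k) * d + 9 * (3 + k)) * n + (7 + k) * d) ∋ solve-∀) k n d ⟩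
    ((2 + k) * d + 9 * (3 + k)) * n + (7 + k) * d                      ∎
    where open ≤-Reasoning

  d′ : ℕ
  d′ = (2 * m ∸ 3) * (m + 1)

  d≡d′ : d ≡ d′
  -- The right side of the ring identity is the form to which `2 * m ∸ 3` computes.
  d≡d′ = cong₂ _*_ (((∀ k → 5 + 2 * k ≡ suc (k + (4 + (k + 0)))) ∋ solve-∀) k) (+-comm 1 m)

  bound : M * d′ ≤ ((m ∸ 2) * d′ + (9 * m ∸ 9)) * n + (m + 3) * d′
  bound = begin
    M * d′                                                  ≡⟨ cong (M *_) d≡d′ ⟨
    M * d                                                   ≤⟨ Md≤ ⟩
    ((2 + k) * d + 9 * (3 + k)) * n + (7 + k) * d           ≡⟨ cong₂ (λ a b → ((2 + k) * a + b) * n + (7 + k) * a) d≡d′ (*-distribˡ-∸ 9 m 1) ⟩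
    ((m ∸ 2) * d′ + (9 * m ∸ 9)) * n + (3 + m) * d′         ≡⟨ cong (λ a → ((m ∸ 2) * d′ + (9 * m ∸ 9)) * n + a * d′) (+-comm 3 m) ⟩
    ((m ∸ 2) * d′ + (9 * m ∸ 9)) * n + (m + 3) * d′         ∎
    where open ≤-Reasoning

theorem7 : (m n : ℕ) → 4 ≤ m → m ≤ n →
    RamseyLeFrac m n
    (((m ∸ 2) * ((2 * m ∸ 3) * (m + 1)) + (9 * m ∸ 9)) * n
    + (m + 3) * ((2 * m ∸ 3) * (m + 1)))
    ((2 * m ∸ 3) * (m + 1))
theorem7 m n 4≤m m≤n with m≤n⇒∃[o]m+o≡n 4≤m
... | k , refl = M , (λ c → Ramsey.monochromatic c y<n refl blob-room 2n≤) , bound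
  where open Arithmetic k n (≤-trans 4≤m m≤n)
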